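{- Let $U:\mathcal{E}\to\mathcal{B}$ be a Lawvere category, where $\mathcal{B}$ has pullbacks. Let $q:\mathcal{E}'\to\mathcal{B}^{\to}$ be obtained by change of base of $U$ along the domain functor $dom:\mathcal{B}^{\to}\to\mathcal{B}$. Then $q$ is a fibred Lawvere category above the codomain fibration $cod:\mathcal{B}^{\to}\to\mathcal{B}$, and for any object $I$ of $\mathcal{B}$, the restriction $q_I$ of $q$ to the fibres above $I$ coincides with the fibration $U/I$.
   Context: A CCU is a fibration with fibred terminal objects whose truth functor $K$ (sending $X$ to a terminal object of the fibre above $X$) has a right adjoint; a Lawvere category is a CCU that is also a bifibration. $\mathcal{B}^{\to}$ is the arrow category; $cod$ and $dom$ send $f:X\to Y$ to $Y$ and $X$; $cod$ is a fibration (cartesian morphisms given by pullbacks), whose fibre above $I$ is the slice $\mathcal{B}/I$. $\mathcal{E}'$ has objects pairs $(f:X\to I,P)$ with $P$ in $\mathcal{E}$ above $X$, and $q(f,P)=f$. For fibrations $U':\mathcal{E}'\to\mathcal{B}'$, $r:\mathcal{B}'\to\mathcal{A}$, $U'$ is a fibred Lawvere category above $r$ if $U'$ is a bifibration with a truth functor $K'$ having a right adjoint $\{ -\}$ such that $K'$ and $\{ -\}$ preserve cartesian morphisms and commute with the projections to $\mathcal{A}$ (via $r$ and $rU'$) and the unit of $K'\dashv\{ -\}$ is vertical with respect to $r$; $q_I$ denotes the restriction of $q$ to the fibre of $cod\circ q$ above $I$, a functor to $\mathcal{B}/I$. $U/I:\mathcal{E}/KI\to\mathcal{B}/I$ sends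 $f:P\to KI$ to $Uf:UP\to I$. -}

module Defs where

-- Hom-sets carry an equivalence relation _≈_; objects are compared with _≡_
-- (K is available, so proofs of object equalities are irrelevant).

open import Level using (Level; _⊔_) renaming (suc to lsuc)
open import Relation.Binary using (Rel; IsEquivalence; Setoid)
open import Relation.Binary.PropositionalEquality using (_≡_; refl)
open import Data.Product using (Σ; _×_; _,_; proj₁; proj₂; Σ-syntax)
import Relation.Binary.Reasoning.Setoid as SetoidR

record Category (o ℓ e : Level) : Set (lsuc (o ⊔ ℓ ⊔ e)) where
  infix  4 _≈_
  infixr 9 _∘_
  infix  4 _⇒_
  field
    Obj       : Set o
    _⇒_       : Obj → Obj → Set ℓ
    _≈_       : ∀ {A B} → Rel (A ⇒ B) e
    id        : ∀ {A} → A ⇒ A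
    _∘_       : ∀ {A B C} → B ⇒ C → A ⇒ B → A ⇒ C
    equiv     : ∀ {A B} → IsEquivalence (_≈_ {A} {B})
    assoc     : ∀ {A B C D} {f : A ⇒ B} {g : B ⇒ C} {h : C ⇒ D} →
                (h ∘ g) ∘ f ≈ h ∘ (g ∘ f)
    identityˡ : ∀ {A B} {f : A ⇒ B} → id ∘ f ≈ f
    identityʳ : ∀ {A B} {f : A ⇒ B} → f ∘ id ≈ f
    ∘-resp-≈  : ∀ {A B C} {f h : B ⇒ C} {g i : A ⇒ B} →
                f ≈ h → g ≈ i → f ∘ g ≈ h ∘ i

  module Equiv {A B : Obj} = IsEquivalence (equiv {A} {B})

  hom-setoid : Obj → Obj → Setoid ℓ e
  hom-setoid A B = record { Carrier = A ⇒ B ; _≈_ = _≈_ ; isEquivalence = equiv }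

  idₑ : ∀ {A B} → A ≡ B → A ⇒ B
  idₑ refl = id

  IsIdentity : ∀ {A B} → A ⇒ B → Set (o ⊔ e)
  IsIdentity {A} {B} m = Σ[ p ∈ A ≡ B ] (m ≈ idₑ p)

  IsIso : ∀ {A B} → A ⇒ B → Set (ℓ ⊔ e)
  IsIso {A} {B} f = Σ[ g ∈ B ⇒ A ] ((g ∘ f ≈ id) × (f ∘ g ≈ id))

record Functor {o ℓ e o' ℓ' e'} (C : Category o ℓ e) (D : Category o' ℓ' e')
       : Set (o ⊔ ℓ ⊔ e ⊔ o' ⊔ ℓ' ⊔ e') where
  private
    module C = Category C
    module D = Category D
  field
    F₀           : C.Obj → D.Obj
    F₁           : ∀ {A B} → A C.⇒ B → F₀ A D.⇒ F₀ B
    identity     : ∀ {A} → F₁ (C.id {A}) D.≈ D.id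
    homomorphism : ∀ {A B X} {f : A C.⇒ B} {g : B C.⇒ X} →
                   F₁ (g C.∘ f) D.≈ F₁ g D.∘ F₁ f
    F-resp-≈     : ∀ {A B} {f g : A C.⇒ B} → f C.≈ g → F₁ f D.≈ F₁ g

open Functor public using (F₀; F₁)

module _ {o ℓ e} (C : Category o ℓ e) where
  open Category C
  IdF : Functor C C
  IdF = record
    { F₀ = λ X → X ; F₁ = λ f → f
    ; identity = Equiv.refl ; homomorphism = Equiv.refl ; F-resp-≈ = λ p → p }

infixr 9 _∘F_
_∘F_ : ∀ {o₁ ℓ₁ e₁ o₂ ℓ₂ e₂ o₃ ℓ₃ e₃}
         {C : Category o₁ ℓ₁ e₁} {D : Category o₂ ℓ₂ e₂} {E : Category o₃ ℓ₃ e₃} →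
       Functor D E → Functor C D → Functor C E
_∘F_ {E = E} G F = record
  { F₀ = λ X → G.F₀ (F.F₀ X)
  ; F₁ = λ f → G.F₁ (F.F₁ f)
  ; identity = E.Equiv.trans (G.F-resp-≈ F.identity) G.identity
  ; homomorphism = E.Equiv.trans (G.F-resp-≈ F.homomorphism) G.homomorphism
  ; F-resp-≈ = λ p → G.F-resp-≈ (F.F-resp-≈ p) }
  where module G = Functor G
        module F = Functor F
        module E = Category E

module _ {o ℓ e o' ℓ' e'} {C : Category o ℓ e} {D : Category o' ℓ' e'} where
  private
    module C = Category C
    module D = Category D

  record NaturalTransformation (F G : Functor C D) : Set (o ⊔ ℓ ⊔ ℓ' ⊔ e') where
    field
      η           : ∀ X → F₀ F X D.⇒ F₀ G X
      commute     : ∀ {X Y} (f : X C.⇒ Y) → η Y D.∘ F₁ F f D.≈ F₁ G f D.∘ η X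

  NaturalIso : (F G : Functor C D) → Set (o ⊔ ℓ ⊔ ℓ' ⊔ e')
  NaturalIso F G = Σ[ α ∈ NaturalTransformation F G ]
                     (∀ X → D.IsIso (NaturalTransformation.η α X))

  infix 4 _≐_
  _≐_ : (F G : Functor C D) → Set (o ⊔ ℓ ⊔ o' ⊔ e')
  F ≐ G = Σ[ eq ∈ (∀ X → F₀ F X ≡ F₀ G X) ]
            (∀ {X Y} (f : X C.⇒ Y) →
               D.idₑ (eq Y) D.∘ F₁ F f D.≈ F₁ G f D.∘ D.idₑ (eq X))

module _ {o ℓ e o' ℓ' e'} {C : Category o ℓ e} {D : Category o' ℓ' e'} where
  IsEquivalenceF : Functor C D → Set (o ⊔ ℓ ⊔ e ⊔ o' ⊔ ℓ' ⊔ e')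
  IsEquivalenceF F = Σ[ G ∈ Functor D C ]
                       (NaturalIso (G ∘F F) (IdF C) × NaturalIso (F ∘F G) (IdF D))

record Adjunction {o ℓ e o' ℓ' e'} {C : Category o ℓ e} {D : Category o' ℓ' e'}
       (L : Functor C D) (R : Functor D C) : Set (o ⊔ ℓ ⊔ e ⊔ o' ⊔ ℓ' ⊔ e') where
  private
    module C = Category C
    module D = Category D
  field
    unit      : NaturalTransformation (IdF C) (R ∘F L)
  open NaturalTransformation unit public renaming (η to η-unit)
  field
    universal : ∀ {X A} (g : X C.⇒ F₀ R A) →
                Σ[ f ∈ F₀ L X D.⇒ A ]
                  ((F₁ R f C.∘ η-unit X C.≈ g) ×
                   (∀ (f' : F₀ L X D.⇒ A) → F₁ R f' C.∘ η-unit X C.≈ g → f' D.≈ f))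

module _ {o ℓ e} (B : Category o ℓ e) where
  open Category B

  HasPullbacks : Set (o ⊔ ℓ ⊔ e)
  HasPullbacks =
    ∀ {X Y Z} (f : X ⇒ Z) (g : Y ⇒ Z) →
      Σ[ P ∈ Obj ] Σ[ p₁ ∈ P ⇒ X ] Σ[ p₂ ∈ P ⇒ Y ]
        ((f ∘ p₁ ≈ g ∘ p₂) ×
         (∀ {Q} (h : Q ⇒ X) (k : Q ⇒ Y) → f ∘ h ≈ g ∘ k →
            Σ[ u ∈ Q ⇒ P ] ((p₁ ∘ u ≈ h) × (p₂ ∘ u ≈ k) ×
              (∀ (u' : Q ⇒ P) → p₁ ∘ u' ≈ h → p₂ ∘ u' ≈ k → u' ≈ u))))

module _ {o ℓ e o' ℓ' e'} {E : Category o' ℓ' e'} {B : Category o ℓ e}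
         (U : Functor E B) where
  private
    module E = Category E
    module B = Category B
    module U = Functor U

  IsCartesian : ∀ {P Q} → P E.⇒ Q → Set (o' ⊔ ℓ' ⊔ e' ⊔ ℓ ⊔ e)
  IsCartesian {P} {Q} φ =
    ∀ {R} (ψ : R E.⇒ Q) (v : U.F₀ R B.⇒ U.F₀ P) → U.F₁ φ B.∘ v B.≈ U.F₁ ψ →
      Σ[ χ ∈ R E.⇒ P ] (((U.F₁ χ B.≈ v) × (φ E.∘ χ E.≈ ψ)) ×
        (∀ (χ' : R E.⇒ P) → U.F₁ χ' B.≈ v → φ E.∘ χ' E.≈ ψ → χ' E.≈ χ))

  IsOpcartesian : ∀ {P Q} → P E.⇒ Q → Set (o' ⊔ ℓ' ⊔ e' ⊔ ℓ ⊔ e)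
  IsOpcartesian {P} {Q} φ =
    ∀ {R} (ψ : P E.⇒ R) (v : U.F₀ Q B.⇒ U.F₀ R) → v B.∘ U.F₁ φ B.≈ U.F₁ ψ →
      Σ[ χ ∈ Q E.⇒ R ] (((U.F₁ χ B.≈ v) × (χ E.∘ φ E.≈ ψ)) ×
        (∀ (χ' : Q E.⇒ R) → U.F₁ χ' B.≈ v → χ' E.∘ φ E.≈ ψ → χ' E.≈ χ))

  IsFibration : Set (o ⊔ ℓ ⊔ e ⊔ o' ⊔ ℓ' ⊔ e')
  IsFibration =
    ∀ (Q : E.Obj) {X} (u : X B.⇒ U.F₀ Q) →
      Σ[ P ∈ E.Obj ] Σ[ φ ∈ P E.⇒ Q ] Σ[ p ∈ U.F₀ P ≡ X ]
        ((U.F₁ φ B.≈ u B.∘ B.idₑ p) × IsCartesian φ)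

  IsOpfibration : Set (o ⊔ ℓ ⊔ e ⊔ o' ⊔ ℓ' ⊔ e')
  IsOpfibration =
    ∀ (P : E.Obj) {Y} (u : U.F₀ P B.⇒ Y) →
      Σ[ Q ∈ E.Obj ] Σ[ φ ∈ P E.⇒ Q ] Σ[ p ∈ U.F₀ Q ≡ Y ]
        ((B.idₑ p B.∘ U.F₁ φ B.≈ u) × IsOpcartesian φ)

  IsBifibration : Set (o ⊔ ℓ ⊔ e ⊔ o' ⊔ ℓ' ⊔ e')
  IsBifibration = IsFibration × IsOpfibration

  -- T is a terminal object of the fibre above U T (fibre morphisms P → T
  -- are the morphisms sent by U to the identity, transported along U P ≡ U T)
  IsFibreTerminal : E.Obj → Set (o ⊔ e ⊔ o' ⊔ ℓ' ⊔ e')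
  IsFibreTerminal T =
    ∀ (P : E.Obj) (p : U.F₀ P ≡ U.F₀ T) →
      Σ[ f ∈ P E.⇒ T ] ((U.F₁ f B.≈ B.idₑ p) ×
        (∀ (g : P E.⇒ T) → U.F₁ g B.≈ B.idₑ p → g E.≈ f))

  HasFibredTerminals : Set (o ⊔ ℓ ⊔ e ⊔ o' ⊔ ℓ' ⊔ e')
  HasFibredTerminals =
    (∀ (X : B.Obj) → Σ[ T ∈ E.Obj ] ((U.F₀ T ≡ X) × IsFibreTerminal T)) ×
    (∀ {P Q} (φ : P E.⇒ Q) → IsCartesian φ → IsFibreTerminal Q → IsFibreTerminal P)

  IsTruthFunctor : Functor B E → Set (o ⊔ ℓ ⊔ e ⊔ o' ⊔ ℓ' ⊔ e')
  IsTruthFunctor K = ((U ∘F K) ≐ IdF B) × (∀ (X : B.Obj) → IsFibreTerminal (F₀ K X))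

  record CCU : Set (o ⊔ ℓ ⊔ e ⊔ o' ⊔ ℓ' ⊔ e') where
    field
      fibration       : IsFibration
      fibredTerminals : HasFibredTerminals
      K               : Functor B E
      truth           : IsTruthFunctor K
      compr           : Functor E B
      K⊣compr         : Adjunction K compr

  record LawvereCategory : Set (o ⊔ ℓ ⊔ e ⊔ o' ⊔ ℓ' ⊔ e') where
    field
      ccu           : CCU
      opfibration   : IsOpfibration
    open CCU ccu public

record FibredLawvere {oA ℓA eA oB ℓB eB oE ℓE eE}
         {A : Category oA ℓA eA} {B' : Category oB ℓB eB} {E' : Category oE ℓE eE}
         (U' : Functor E' B') (r : Functor B' A)
         : Set (oA ⊔ ℓA ⊔ eA ⊔ oB ⊔ ℓB ⊔ eB ⊔ oE ⊔ ℓE ⊔ eE) where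
  private
    module B' = Category B'
    module E' = Category E'
    module A  = Category A
  field
    r-fibration      : IsFibration r
    bifibration      : IsBifibration U'
    fibredTerminals  : HasFibredTerminals U'
    K'               : Functor B' E'
    truth            : IsTruthFunctor U' K'
    compr            : Functor E' B'
    K'⊣compr         : Adjunction K' compr
    K'-cartesian     : ∀ {X Y} (f : X B'.⇒ Y) →
                       IsCartesian r f → IsCartesian (r ∘F U') (F₁ K' f)
    compr-cartesian  : ∀ {P Q} (φ : P E'.⇒ Q) →
                       IsCartesian (r ∘F U') φ → IsCartesian r (F₁ compr φ)
    K'-over          : ((r ∘F U') ∘F K') ≐ r
    compr-over       : (r ∘F compr) ≐ (r ∘F U')
    unit-vertical    : ∀ (X : B'.Obj) →
                       A.IsIdentity (F₁ r (Adjunction.η-unit K'⊣compr X))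

module _ {o ℓ e} (C : Category o ℓ e) where
  open Category C

  record ArrowObj : Set (o ⊔ ℓ) where
    constructor arr
    field
      {src} : Obj
      {tgt} : Obj
      map   : src ⇒ tgt

  record ArrowHom (f g : ArrowObj) : Set (ℓ ⊔ e) where
    constructor sq
    private
      module f = ArrowObj f
      module g = ArrowObj g
    field
      u       : f.src ⇒ g.src
      v       : f.tgt ⇒ g.tgt
      commute : g.map ∘ u ≈ v ∘ f.map

  Arrow : Category (o ⊔ ℓ) (ℓ ⊔ e) e
  Arrow = record
    { Obj = ArrowObj
    ; _⇒_ = ArrowHom
    ; _≈_ = λ α β → (ArrowHom.u α ≈ ArrowHom.u β) × (ArrowHom.v α ≈ ArrowHom.v β)
    ; id = sq id id (Equiv.trans identityʳ (Equiv.sym identityˡ))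
    ; _∘_ = λ { {arr f} {arr g} {arr h} (sq u v c) (sq u' v' c') →
                sq (u ∘ u') (v ∘ v') (let open SetoidR (hom-setoid _ _) in begin
                  h ∘ (u ∘ u')   ≈⟨ Equiv.sym assoc ⟩
                  (h ∘ u) ∘ u'   ≈⟨ ∘-resp-≈ c Equiv.refl ⟩
                  (v ∘ g) ∘ u'   ≈⟨ assoc ⟩
                  v ∘ (g ∘ u')   ≈⟨ ∘-resp-≈ Equiv.refl c' ⟩
                  v ∘ (v' ∘ f)   ≈⟨ Equiv.sym assoc ⟩
                  (v ∘ v') ∘ f   ∎) }
    ; equiv = record
        { refl = Equiv.refl , Equiv.refl
        ; sym = λ (p , q) → Equiv.sym p , Equiv.sym q
        ; trans = λ (p , q) (p' , q') → Equiv.trans p p' , Equiv.trans q q' }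
    ; assoc = assoc , assoc
    ; identityˡ = identityˡ , identityˡ
    ; identityʳ = identityʳ , identityʳ
    ; ∘-resp-≈ = λ (p , q) (p' , q') → ∘-resp-≈ p p' , ∘-resp-≈ q q'
    }

  dom : Functor Arrow C
  dom = record
    { F₀ = ArrowObj.src ; F₁ = ArrowHom.u
    ; identity = Equiv.refl ; homomorphism = Equiv.refl ; F-resp-≈ = proj₁ }

  cod : Functor Arrow C
  cod = record
    { F₀ = ArrowObj.tgt ; F₁ = ArrowHom.v
    ; identity = Equiv.refl ; homomorphism = Equiv.refl ; F-resp-≈ = proj₂ }

  record SliceObj (I : Obj) : Set (o ⊔ ℓ) where
    constructor sliceobj
    field
      {base} : Obj
      arrow  : base ⇒ I

  record SliceHom {I : Obj} (X Y : SliceObj I) : Set (ℓ ⊔ e) where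
    constructor slicehom
    field
      h       : SliceObj.base X ⇒ SliceObj.base Y
      commute : SliceObj.arrow Y ∘ h ≈ SliceObj.arrow X

  Slice : Obj → Category (o ⊔ ℓ) (ℓ ⊔ e) e
  Slice I = record
    { Obj = SliceObj I
    ; _⇒_ = SliceHom
    ; _≈_ = λ a b → SliceHom.h a ≈ SliceHom.h b
    ; id = slicehom id identityʳ
    ; _∘_ = λ { {sliceobj f} {sliceobj g} {sliceobj k} (slicehom h c) (slicehom h' c') →
                slicehom (h ∘ h') (let open SetoidR (hom-setoid _ _) in begin
                  k ∘ (h ∘ h')  ≈⟨ Equiv.sym assoc ⟩
                  (k ∘ h) ∘ h'  ≈⟨ ∘-resp-≈ c Equiv.refl ⟩
                  g ∘ h'        ≈⟨ c' ⟩
                  f             ∎) }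
    ; equiv = record { refl = Equiv.refl ; sym = Equiv.sym ; trans = Equiv.trans }
    ; assoc = assoc
    ; identityˡ = identityˡ
    ; identityʳ = identityʳ
    ; ∘-resp-≈ = ∘-resp-≈
    }

module _ {o ℓ e o' ℓ' e'} {C : Category o ℓ e} {D : Category o' ℓ' e'}
         (p : Functor C D) (I : Category.Obj D) where
  private
    module C = Category C
    module D = Category D
    module p = Functor p

  record FibreObj : Set (o ⊔ o') where
    constructor fibreobj
    field
      {obj} : C.Obj
      over  : p.F₀ obj ≡ I

  record FibreHom (X Y : FibreObj) : Set (ℓ ⊔ e') where
    constructor fibrehom
    field
      mor      : FibreObj.obj X C.⇒ FibreObj.obj Y
      vertical : D.idₑ (FibreObj.over Y) D.∘ p.F₁ mor D.≈ D.idₑ (FibreObj.over X)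

  Fibre : Category (o ⊔ o') (ℓ ⊔ e') e
  Fibre = record
    { Obj = FibreObj
    ; _⇒_ = FibreHom
    ; _≈_ = λ a b → FibreHom.mor a C.≈ FibreHom.mor b
    ; id = λ {X} → fibrehom C.id (D.Equiv.trans (D.∘-resp-≈ D.Equiv.refl p.identity) D.identityʳ)
    ; _∘_ = λ { {fibreobj ex} {fibreobj ey} {fibreobj ez} (fibrehom g vg) (fibrehom f vf) →
                fibrehom (g C.∘ f) (let open SetoidR (D.hom-setoid _ _) in begin
                  D.idₑ ez D.∘ p.F₁ (g C.∘ f)        ≈⟨ D.∘-resp-≈ D.Equiv.refl p.homomorphism ⟩
                  D.idₑ ez D.∘ (p.F₁ g D.∘ p.F₁ f)   ≈⟨ D.Equiv.sym D.assoc ⟩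
                  (D.idₑ ez D.∘ p.F₁ g) D.∘ p.F₁ f   ≈⟨ D.∘-resp-≈ vg D.Equiv.refl ⟩
                  D.idₑ ey D.∘ p.F₁ f                ≈⟨ vf ⟩
                  D.idₑ ex                           ∎) }
    ; equiv = record { refl = C.Equiv.refl ; sym = C.Equiv.sym ; trans = C.Equiv.trans }
    ; assoc = C.assoc
    ; identityˡ = C.identityˡ
    ; identityʳ = C.identityʳ
    ; ∘-resp-≈ = C.∘-resp-≈
    }

module _ {o ℓ e o' ℓ' e' oc ℓc ec}
         {E : Category o' ℓ' e'} {B : Category o ℓ e} {C : Category oc ℓc ec}
         (U : Functor E B) (F : Functor C B) where
  private
    module E = Category E
    module B = Category B
    module C = Category C
    module U = Functor U
    module F = Functor F

  record PbObj : Set (o ⊔ o' ⊔ oc) where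
    constructor pbobj
    field
      idx  : C.Obj
      fib  : E.Obj
      over : U.F₀ fib ≡ F.F₀ idx

  record PbHom (X Y : PbObj) : Set (ℓ ⊔ e ⊔ ℓ' ⊔ ℓc) where
    constructor pbhom
    private
      module X = PbObj X
      module Y = PbObj Y
    field
      idx-mor : X.idx C.⇒ Y.idx
      fib-mor : X.fib E.⇒ Y.fib
      agree   : B.idₑ Y.over B.∘ U.F₁ fib-mor B.≈ F.F₁ idx-mor B.∘ B.idₑ X.over

  ChangeOfBase : Category (o ⊔ o' ⊔ oc) (ℓ ⊔ e ⊔ ℓ' ⊔ ℓc) (e' ⊔ ec)
  ChangeOfBase = record
    { Obj = PbObj
    ; _⇒_ = PbHom
    ; _≈_ = λ a b → (PbHom.idx-mor a C.≈ PbHom.idx-mor b) × (PbHom.fib-mor a E.≈ PbHom.fib-mor b)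
    ; id = λ { {pbobj _ _ ex} → pbhom C.id E.id (let open SetoidR (B.hom-setoid _ _) in begin
             B.idₑ ex B.∘ U.F₁ E.id  ≈⟨ B.∘-resp-≈ B.Equiv.refl U.identity ⟩
             B.idₑ ex B.∘ B.id       ≈⟨ B.identityʳ ⟩
             B.idₑ ex                ≈⟨ B.Equiv.sym B.identityˡ ⟩
             B.id B.∘ B.idₑ ex       ≈⟨ B.∘-resp-≈ (B.Equiv.sym F.identity) B.Equiv.refl ⟩
             F.F₁ C.id B.∘ B.idₑ ex  ∎) }
    ; _∘_ = λ { {pbobj _ _ ex} {pbobj _ _ ey} {pbobj _ _ ez} (pbhom a m h) (pbhom a' m' h') →
                pbhom (a C.∘ a') (m E.∘ m') (let open SetoidR (B.hom-setoid _ _) in begin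
                  B.idₑ ez B.∘ U.F₁ (m E.∘ m')            ≈⟨ B.∘-resp-≈ B.Equiv.refl U.homomorphism ⟩
                  B.idₑ ez B.∘ (U.F₁ m B.∘ U.F₁ m')       ≈⟨ B.Equiv.sym B.assoc ⟩
                  (B.idₑ ez B.∘ U.F₁ m) B.∘ U.F₁ m'       ≈⟨ B.∘-resp-≈ h B.Equiv.refl ⟩
                  (F.F₁ a B.∘ B.idₑ ey) B.∘ U.F₁ m'       ≈⟨ B.assoc ⟩
                  F.F₁ a B.∘ (B.idₑ ey B.∘ U.F₁ m')       ≈⟨ B.∘-resp-≈ B.Equiv.refl h' ⟩
                  F.F₁ a B.∘ (F.F₁ a' B.∘ B.idₑ ex)       ≈⟨ B.Equiv.sym B.assoc ⟩
                  (F.F₁ a B.∘ F.F₁ a') B.∘ B.idₑ ex       ≈⟨ B.∘-resp-≈ (B.Equiv.sym F.homomorphism) B.Equiv.refl ⟩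
                  F.F₁ (a C.∘ a') B.∘ B.idₑ ex            ∎) }
    ; equiv = record
        { refl = C.Equiv.refl , E.Equiv.refl
        ; sym = λ (p , q) → C.Equiv.sym p , E.Equiv.sym q
        ; trans = λ (p , q) (p' , q') → C.Equiv.trans p p' , E.Equiv.trans q q' }
    ; assoc = C.assoc , E.assoc
    ; identityˡ = C.identityˡ , E.identityˡ
    ; identityʳ = C.identityʳ , E.identityʳ
    ; ∘-resp-≈ = λ (p , q) (p' , q') → C.∘-resp-≈ p p' , E.∘-resp-≈ q q'
    }

  ChangeOfBase-proj : Functor ChangeOfBase C
  ChangeOfBase-proj = record
    { F₀ = PbObj.idx ; F₁ = PbHom.idx-mor
    ; identity = C.Equiv.refl ; homomorphism = C.Equiv.refl ; F-resp-≈ = proj₁ }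

module _ {o ℓ e o' ℓ' e'} {B : Category o ℓ e} {E : Category o' ℓ' e'}
         (U : Functor E B) where
  private
    module E = Category E
    module B = Category B
    module U = Functor U

  E′ : Category (o ⊔ ℓ ⊔ o') (ℓ ⊔ e ⊔ ℓ') (e' ⊔ e)
  E′ = ChangeOfBase U (dom B)

  q : Functor E′ (Arrow B)
  q = ChangeOfBase-proj U (dom B)

  q-restr : (I : B.Obj) → Functor (Fibre (cod B ∘F q) I) (Slice B I)
  q-restr I = record
    { F₀ = λ { (fibreobj {pbobj (arr f) _ _} e) → sliceobj (B.idₑ e B.∘ f) }
    ; F₁ = λ { {fibreobj {pbobj (arr f) _ _} e} {fibreobj {pbobj (arr g) _ _} e'}
                 (fibrehom (pbhom (sq u v c) _ _) vert) →
               slicehom u (let open SetoidR (B.hom-setoid _ _) in begin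
                 (B.idₑ e' B.∘ g) B.∘ u   ≈⟨ B.assoc ⟩
                 B.idₑ e' B.∘ (g B.∘ u)   ≈⟨ B.∘-resp-≈ B.Equiv.refl c ⟩
                 B.idₑ e' B.∘ (v B.∘ f)   ≈⟨ B.Equiv.sym B.assoc ⟩
                 (B.idₑ e' B.∘ v) B.∘ f   ≈⟨ B.∘-resp-≈ vert B.Equiv.refl ⟩
                 B.idₑ e B.∘ f            ∎) }
    ; identity = B.Equiv.refl
    ; homomorphism = B.Equiv.refl
    ; F-resp-≈ = λ p → proj₁ (proj₁ p)
    }

  U/I : (K : Functor B E) → IsTruthFunctor U K → (I : B.Obj) →
        Functor (Slice E (F₀ K I)) (Slice B I)
  U/I K tK I = record
    { F₀ = λ { (sliceobj g) → sliceobj (B.idₑ eK B.∘ U.F₁ g) }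
    ; F₁ = λ { {sliceobj g} {sliceobj g'} (slicehom h c) →
               slicehom (U.F₁ h) (let open SetoidR (B.hom-setoid _ _) in begin
                 (B.idₑ eK B.∘ U.F₁ g') B.∘ U.F₁ h   ≈⟨ B.assoc ⟩
                 B.idₑ eK B.∘ (U.F₁ g' B.∘ U.F₁ h)   ≈⟨ B.∘-resp-≈ B.Equiv.refl (B.Equiv.sym U.homomorphism) ⟩
                 B.idₑ eK B.∘ U.F₁ (g' E.∘ h)        ≈⟨ B.∘-resp-≈ B.Equiv.refl (U.F-resp-≈ c) ⟩
                 B.idₑ eK B.∘ U.F₁ g                 ∎) }
    ; identity = U.identity
    ; homomorphism = U.homomorphism
    ; F-resp-≈ = U.F-resp-≈
    }
    where eK : U.F₀ (F₀ K I) ≡ I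
          eK = proj₁ (proj₁ tK) I

-- The fibration structure of q is inherited from U: a morphism of E′ whose E-component is
-- (op)cartesian for U is (op)cartesian for q, and cod is a fibration since B has pullbacks.
-- Because fibre terminals are stable under reindexing, maps P → K X correspond to maps
-- U P → X (U ⊣ K, via K-lift). So K′ (f : X → I) = (f , K X) picks the terminal objects of
-- the fibres of q, and K′ f is cartesian whenever f is. Comprehension lifts to
-- {(f , P)}′ = f ∘ π P, with π P = U (ε P) : {P} → U P; sending (a , b) : g → {(f , P)}′ to
-- (π P ∘ a , b) over ♯ a makes K′ ⊣ {-}′. The unit of this adjunction is the identity on
-- codomains, so {-}′ preserves cartesian morphisms. Finally, an object of the fibre of
-- cod ∘ q over I is a pair (f : U P → I , P), and f ↦ K-lift f : P → K I is an equivalence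
-- with E / K I, with inverse k ↦ U k, under which U/I becomes q_I.

module Submission where

open import Defs
open import Level using (Level)
open import Data.Product using (Σ; _×_; Σ-syntax; _,_; proj₁; proj₂)
open import Relation.Binary.PropositionalEquality using (_≡_; refl; sym)
import Relation.Binary.Reasoning.Setoid as SetoidR

module CategoryProperties {o ℓ e} (C : Category o ℓ e) where
  open Category C

  module HomReasoning {A B : Obj} = SetoidR (hom-setoid A B)

  infixr 4 _⟩∘⟨_ refl⟩∘⟨_
  infixl 5 _⟩∘⟨refl

  _⟩∘⟨_ : ∀ {A B D} {f h : B ⇒ D} {g i : A ⇒ B} → f ≈ h → g ≈ i → f ∘ g ≈ h ∘ i
  _⟩∘⟨_ = ∘-resp-≈

  refl⟩∘⟨_ : ∀ {A B D} {f : B ⇒ D} {g i : A ⇒ B} → g ≈ i → f ∘ g ≈ f ∘ i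
  refl⟩∘⟨ p = ∘-resp-≈ Equiv.refl p

  _⟩∘⟨refl : ∀ {A B D} {f h : B ⇒ D} {g : A ⇒ B} → f ≈ h → f ∘ g ≈ h ∘ g
  p ⟩∘⟨refl = ∘-resp-≈ p Equiv.refl

  sym-assoc : ∀ {A B D F} {f : A ⇒ B} {g : B ⇒ D} {h : D ⇒ F} → h ∘ (g ∘ f) ≈ (h ∘ g) ∘ f
  sym-assoc = Equiv.sym assoc

  id-comm : ∀ {A B} {f : A ⇒ B} → id ∘ f ≈ f ∘ id
  id-comm = Equiv.trans identityˡ (Equiv.sym identityʳ)

  idₑ-sym-inverse : ∀ {A B} (p : A ≡ B) → idₑ p ∘ idₑ (sym p) ≈ id
  idₑ-sym-inverse refl = identityˡ

  idₑ-switchʳ : ∀ {A B D} (p : A ≡ B) {f : A ⇒ D} {g : B ⇒ D} →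
                f ≈ g ∘ idₑ p → f ∘ idₑ (sym p) ≈ g
  idₑ-switchʳ refl f≈g = Equiv.trans identityʳ (Equiv.trans f≈g identityʳ)

  idₑ-sym-inverseˡ : ∀ {A B} (p : A ≡ B) → idₑ (sym p) ∘ idₑ p ≈ id
  idₑ-sym-inverseˡ refl = identityˡ

  idₑ-cancelˡ : ∀ {A B D} (p : B ≡ D) {f g : A ⇒ B} → idₑ p ∘ f ≈ idₑ p ∘ g → f ≈ g
  idₑ-cancelˡ refl pf≈pg = Equiv.trans (Equiv.sym identityˡ) (Equiv.trans pf≈pg identityˡ)

  idₑ-inverse-commute : ∀ {A B} (p : A ≡ B) {f : B ⇒ A} → f ∘ idₑ p ≈ id → idₑ p ∘ f ≈ id
  idₑ-inverse-commute refl fp≈id = Equiv.trans id-comm fp≈id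

  Agree : ∀ {X X' Y Y'} → X ≡ X' → Y ≡ Y' → X ⇒ Y → X' ⇒ Y' → Set e
  Agree p q f g = idₑ q ∘ f ≈ g ∘ idₑ p

  transport : ∀ {X X' Y Y'} → X ≡ X' → Y ≡ Y' → X' ⇒ Y' → X ⇒ Y
  transport p q g = (idₑ (sym q) ∘ g) ∘ idₑ p

  agree-refl : ∀ {X Y} {f g : X ⇒ Y} → f ≈ g → Agree refl refl f g
  agree-refl f≈g = Equiv.trans identityˡ (Equiv.trans f≈g (Equiv.sym identityʳ))

  agree-refl⁻ : ∀ {X Y} {f g : X ⇒ Y} → Agree refl refl f g → f ≈ g
  agree-refl⁻ a = Equiv.trans (Equiv.sym identityˡ) (Equiv.trans a identityʳ)

  agree⇒≈transport : ∀ {X X' Y Y'} (p : X ≡ X') (q : Y ≡ Y') {f : X ⇒ Y} {g : X' ⇒ Y'} →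
                     Agree p q f g → f ≈ transport p q g
  agree⇒≈transport refl refl a = Equiv.trans (agree-refl⁻ a) (Equiv.sym (Equiv.trans identityʳ identityˡ))

  ≈transport⇒agree : ∀ {X X' Y Y'} (p : X ≡ X') (q : Y ≡ Y') {f : X ⇒ Y} {g : X' ⇒ Y'} →
                     f ≈ transport p q g → Agree p q f g
  ≈transport⇒agree refl refl a = agree-refl (Equiv.trans a (Equiv.trans identityʳ identityˡ))

  agree-uniqueˡ : ∀ {X X' Y Y'} (p : X ≡ X') (q : Y ≡ Y') {f f' : X ⇒ Y} {g : X' ⇒ Y'} →
                  Agree p q f g → Agree p q f' g → f ≈ f'
  agree-uniqueˡ p q a a' = Equiv.trans (agree⇒≈transport p q a) (Equiv.sym (agree⇒≈transport p q a'))

  agree-uniqueʳ : ∀ {X X' Y Y'} (p : X ≡ X') (q : Y ≡ Y') {f : X ⇒ Y} {g g' : X' ⇒ Y'} →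
                  Agree p q f g → Agree p q f g' → g ≈ g'
  agree-uniqueʳ refl refl a a' = Equiv.trans (Equiv.sym (agree-refl⁻ a)) (agree-refl⁻ a')

  agree-∘ : ∀ {X X' Y Y' Z Z'} (p : X ≡ X') (q : Y ≡ Y') (r : Z ≡ Z')
              {f : X ⇒ Y} {g : X' ⇒ Y'} {f' : Y ⇒ Z} {g' : Y' ⇒ Z'} →
            Agree q r f' g' → Agree p q f g → Agree p r (f' ∘ f) (g' ∘ g)
  agree-∘ refl refl refl a' a = agree-refl (agree-refl⁻ a' ⟩∘⟨ agree-refl⁻ a)

module SliceProperties {o ℓ e} (C : Category o ℓ e) where
  open Category C

  slice-id : ∀ {I X} {k k' : X ⇒ I} → k ≈ k' → SliceHom C (sliceobj k) (sliceobj k')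
  slice-id k≈k' = slicehom id (Equiv.trans identityʳ (Equiv.sym k≈k'))

  slice-id-iso : ∀ {I X} {k k' : X ⇒ I} (k≈k' : k ≈ k') → Category.IsIso (Slice C I) (slice-id k≈k')
  slice-id-iso k≈k' = slice-id (Equiv.sym k≈k') , identityˡ , identityˡ

module ChangeOfBaseProperties {o ℓ e o' ℓ' e' oc ℓc ec}
         {E : Category o' ℓ' e'} {B : Category o ℓ e} {C : Category oc ℓc ec}
         (U : Functor E B) (F : Functor C B) where
  private
    module E = Category E
    module B = Category B
    module C = Category C
    module U = Functor U
    module F = Functor F
    p = ChangeOfBase-proj U F
  open CategoryProperties B

  fib-cartesian⇒cartesian : ∀ {X Y : PbObj U F} (h : PbHom U F X Y) →
                            IsCartesian U (PbHom.fib-mor h) → IsCartesian p h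
  fib-cartesian⇒cartesian {pbobj _ _ ovP} {pbobj _ _ ovQ} (pbhom _ φ agφ) cart
                          {pbobj _ _ ovR} (pbhom _ n agn) γ aγ≈β =
    let k , (Uk≈v , φk≈n) , k-unique = cart n v Uφv≈Un in
    pbhom γ k (≈transport⇒agree ovR ovP Uk≈v) , (C.Equiv.refl , aγ≈β , φk≈n) ,
    λ { (pbhom γ' k' agk') γ'≈γ (_ , φk'≈n) →
          γ'≈γ ,
          k-unique k' (agree⇒≈transport ovR ovP (B.Equiv.trans agk' (F.F-resp-≈ γ'≈γ ⟩∘⟨refl))) φk'≈n }
    where
      v = transport ovR ovP (F.F₁ γ)
      Uφv≈Un : U.F₁ φ B.∘ v B.≈ U.F₁ n
      Uφv≈Un = agree-uniqueˡ ovR ovQ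
        (agree-∘ ovR ovP ovQ agφ (≈transport⇒agree ovR ovP B.Equiv.refl))
        (B.Equiv.trans agn (B.Equiv.trans (F.F-resp-≈ (C.Equiv.sym aγ≈β)) F.homomorphism ⟩∘⟨refl))

  fib-opcartesian⇒opcartesian : ∀ {X Y : PbObj U F} (h : PbHom U F X Y) →
                                IsOpcartesian U (PbHom.fib-mor h) → IsOpcartesian p h
  fib-opcartesian⇒opcartesian {pbobj _ _ ovP} {pbobj _ _ ovQ} (pbhom _ φ agφ) opcart
                              {pbobj _ _ ovR} (pbhom _ n agn) γ γa≈β =
    let k , (Uk≈v , kφ≈n) , k-unique = opcart n v vUφ≈Un in
    pbhom γ k (≈transport⇒agree ovQ ovR Uk≈v) , (C.Equiv.refl , γa≈β , kφ≈n) ,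
    λ { (pbhom γ' k' agk') γ'≈γ (_ , k'φ≈n) →
          γ'≈γ ,
          k-unique k' (agree⇒≈transport ovQ ovR (B.Equiv.trans agk' (F.F-resp-≈ γ'≈γ ⟩∘⟨refl))) k'φ≈n }
    where
      v = transport ovQ ovR (F.F₁ γ)
      vUφ≈Un : v B.∘ U.F₁ φ B.≈ U.F₁ n
      vUφ≈Un = agree-uniqueˡ ovP ovR
        (agree-∘ ovP ovQ ovR (≈transport⇒agree ovQ ovR B.Equiv.refl) agφ)
        (B.Equiv.trans agn (B.Equiv.trans (F.F-resp-≈ (C.Equiv.sym γa≈β)) F.homomorphism ⟩∘⟨refl))

  isFibration : IsFibration U → IsFibration p
  isFibration fib (pbobj d Q ovQ) {c} a =
    let P , φ , ovP , Uφ≈ , cart = fib Q (B.idₑ (sym ovQ) B.∘ F.F₁ a)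
        φ' = pbhom a φ (≈transport⇒agree ovP ovQ Uφ≈)
    in pbobj c P ovP , φ' , refl , C.Equiv.sym C.identityʳ , fib-cartesian⇒cartesian φ' cart

  isOpfibration : IsOpfibration U → IsOpfibration p
  isOpfibration opfib (pbobj c P ovP) {d} a =
    let Q , φ , ovQ , Uφ≈ , opcart = opfib P (F.F₁ a B.∘ B.idₑ ovP)
        φ' = pbhom a φ Uφ≈
    in pbobj d Q ovQ , φ' , refl , C.identityˡ , fib-opcartesian⇒opcartesian φ' opcart

module AdjunctionProperties {o ℓ e o' ℓ' e'} {C : Category o ℓ e} {D : Category o' ℓ' e'}
         {L : Functor C D} {R : Functor D C} (adj : Adjunction L R) where
  private
    module C = Category C
    module D = Category D
    module L = Functor L
    module R = Functor R
  open Adjunction adj using (universal) renaming (η-unit to η; commute to η-commute) public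
  open Category C
  open CategoryProperties C
  open HomReasoning

  ♯ : ∀ {X A} → X ⇒ R.F₀ A → L.F₀ X D.⇒ A
  ♯ g = proj₁ (universal g)

  ♯-spec : ∀ {X A} (g : X ⇒ R.F₀ A) → R.F₁ (♯ g) ∘ η X ≈ g
  ♯-spec g = proj₁ (proj₂ (universal g))

  ♯-unique : ∀ {X A} {g : X ⇒ R.F₀ A} (f : L.F₀ X D.⇒ A) → R.F₁ f ∘ η X ≈ g → f D.≈ ♯ g
  ♯-unique {g = g} = proj₂ (proj₂ (universal g))

  transpose-injective : ∀ {X A} {f f' : L.F₀ X D.⇒ A} →
                        R.F₁ f ∘ η X ≈ R.F₁ f' ∘ η X → f D.≈ f'
  transpose-injective {f' = f'} Rf≈Rf' =
    D.Equiv.trans (♯-unique _ Rf≈Rf') (D.Equiv.sym (♯-unique f' Equiv.refl))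

  ♯-resp-≈ : ∀ {X A} {g g' : X ⇒ R.F₀ A} → g ≈ g' → ♯ g D.≈ ♯ g'
  ♯-resp-≈ {g = g} g≈g' = ♯-unique (♯ g) (Equiv.trans (♯-spec g) g≈g')

  ♯-natural : ∀ {X A A'} (m : A D.⇒ A') (g : X ⇒ R.F₀ A) → m D.∘ ♯ g D.≈ ♯ (R.F₁ m ∘ g)
  ♯-natural {X} m g = ♯-unique (m D.∘ ♯ g) (begin
    R.F₁ (m D.∘ ♯ g) ∘ η X         ≈⟨ R.homomorphism ⟩∘⟨refl ⟩
    (R.F₁ m ∘ R.F₁ (♯ g)) ∘ η X    ≈⟨ assoc ⟩
    R.F₁ m ∘ (R.F₁ (♯ g) ∘ η X)    ≈⟨ refl⟩∘⟨ ♯-spec g ⟩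
    R.F₁ m ∘ g                     ∎)

  ε : ∀ A → L.F₀ (R.F₀ A) D.⇒ A
  ε A = ♯ id

  zag : ∀ A → R.F₁ (ε A) ∘ η (R.F₀ A) ≈ id
  zag A = ♯-spec id

  R-ε∘L : ∀ {X A} (s : X ⇒ R.F₀ A) → R.F₁ (ε A D.∘ L.F₁ s) ∘ η X ≈ s
  R-ε∘L {X} {A} s = begin
    R.F₁ (ε A D.∘ L.F₁ s) ∘ η X          ≈⟨ R.homomorphism ⟩∘⟨refl ⟩
    (R.F₁ (ε A) ∘ R.F₁ (L.F₁ s)) ∘ η X   ≈⟨ assoc ⟩
    R.F₁ (ε A) ∘ (R.F₁ (L.F₁ s) ∘ η X)   ≈⟨ refl⟩∘⟨ Equiv.sym (η-commute s) ⟩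
    R.F₁ (ε A) ∘ (η (R.F₀ A) ∘ s)        ≈⟨ sym-assoc ⟩
    (R.F₁ (ε A) ∘ η (R.F₀ A)) ∘ s        ≈⟨ zag A ⟩∘⟨refl ⟩
    id ∘ s                               ≈⟨ identityˡ ⟩
    s                                    ∎

  ♯≈ε∘L : ∀ {X A} (s : X ⇒ R.F₀ A) → ♯ s D.≈ ε A D.∘ L.F₁ s
  ♯≈ε∘L s = D.Equiv.sym (♯-unique _ (R-ε∘L s))

  ε-natural : ∀ {A B} (m : A D.⇒ B) → m D.∘ ε A D.≈ ε B D.∘ L.F₁ (R.F₁ m)
  ε-natural {A} {B} m = transpose-injective (begin
    R.F₁ (m D.∘ ε A) ∘ η (R.F₀ A)          ≈⟨ R.homomorphism ⟩∘⟨refl ⟩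
    (R.F₁ m ∘ R.F₁ (ε A)) ∘ η (R.F₀ A)     ≈⟨ assoc ⟩
    R.F₁ m ∘ (R.F₁ (ε A) ∘ η (R.F₀ A))     ≈⟨ refl⟩∘⟨ zag A ⟩
    R.F₁ m ∘ id                            ≈⟨ identityʳ ⟩
    R.F₁ m                                 ≈⟨ Equiv.sym (R-ε∘L (R.F₁ m)) ⟩
    R.F₁ (ε B D.∘ L.F₁ (R.F₁ m)) ∘ η (R.F₀ A) ∎)

  zig : ∀ X → ε (L.F₀ X) D.∘ L.F₁ (η X) D.≈ D.id
  zig X = transpose-injective (begin
    R.F₁ (ε (L.F₀ X) D.∘ L.F₁ (η X)) ∘ η X ≈⟨ R-ε∘L (η X) ⟩
    η X                                    ≈⟨ Equiv.sym identityˡ ⟩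
    id ∘ η X                               ≈⟨ Equiv.sym R.identity ⟩∘⟨refl ⟩
    R.F₁ D.id ∘ η X                        ∎)

module _ {oA ℓA eA oB ℓB eB oE ℓE eE}
         {A : Category oA ℓA eA} {B : Category oB ℓB eB} {E : Category oE ℓE eE}
         (r : Functor B A) {L : Functor B E} {G : Functor E B} (adj : Adjunction L G) where
  private
    module A = Category A
    module B = Category B
    module E = Category E
    module r = Functor r
    module G = Functor G
    module BP = CategoryProperties B
  open AdjunctionProperties adj
  open Category A
  open CategoryProperties A

  -- The lift of ψ is the transpose back of the (r ∘ G)-lift of ♯ ψ; r η is invertible,
  -- so base maps can be moved between X and G (L X).
  right-adjoint-preserves-cartesian : (∀ X → A.IsIdentity (r.F₁ (η X))) →
                                      ∀ {P Q} (φ : P E.⇒ Q) →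
                                      IsCartesian (r ∘F G) φ → IsCartesian r (G.F₁ φ)
  right-adjoint-preserves-cartesian vertical φ φ-cartesian {X} ψ w rGφ∘w≈rψ =
    let χ , (rGχ≈w' , φχ≈♯ψ) , χ-unique = φ-cartesian (♯ ψ) w' rGφ∘w'≈rG♯ψ in
    G.F₁ χ B.∘ η X ,
    (r-untranspose χ rGχ≈w' , Gφ∘untranspose χ φχ≈♯ψ) ,
    λ χ₂ rχ₂≈w Gφχ₂≈ψ → B.Equiv.trans (B.Equiv.sym (♯-spec χ₂))
      (G.F-resp-≈ (χ-unique (♯ χ₂) (Equiv.trans (r-transpose χ₂) (rχ₂≈w ⟩∘⟨refl))
                    (E.Equiv.trans (♯-natural φ χ₂) (♯-resp-≈ Gφχ₂≈ψ))) BP.⟩∘⟨refl)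
    where
      e = proj₁ (vertical X)
      w' = w ∘ idₑ (sym e)
      open HomReasoning

      r-G∘η : ∀ {P'} (h : F₀ L X E.⇒ P') → r.F₁ (G.F₁ h B.∘ η X) ≈ r.F₁ (G.F₁ h) ∘ idₑ e
      r-G∘η h = Equiv.trans r.homomorphism (refl⟩∘⟨ proj₂ (vertical X))

      r-transpose : ∀ {P'} (g : X B.⇒ G.F₀ P') → r.F₁ (G.F₁ (♯ g)) ≈ r.F₁ g ∘ idₑ (sym e)
      r-transpose g = begin
        r.F₁ (G.F₁ (♯ g))                          ≈⟨ identityʳ ⟨
        r.F₁ (G.F₁ (♯ g)) ∘ id                     ≈⟨ refl⟩∘⟨ idₑ-sym-inverse e ⟨
        r.F₁ (G.F₁ (♯ g)) ∘ (idₑ e ∘ idₑ (sym e))  ≈⟨ sym-assoc ⟩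
        (r.F₁ (G.F₁ (♯ g)) ∘ idₑ e) ∘ idₑ (sym e)  ≈⟨ Equiv.sym (r-G∘η (♯ g)) ⟩∘⟨refl ⟩
        r.F₁ (G.F₁ (♯ g) B.∘ η X) ∘ idₑ (sym e)    ≈⟨ r.F-resp-≈ (♯-spec g) ⟩∘⟨refl ⟩
        r.F₁ g ∘ idₑ (sym e)                       ∎

      rGφ∘w'≈rG♯ψ : r.F₁ (G.F₁ φ) ∘ w' ≈ r.F₁ (G.F₁ (♯ ψ))
      rGφ∘w'≈rG♯ψ = begin
        r.F₁ (G.F₁ φ) ∘ (w ∘ idₑ (sym e))   ≈⟨ sym-assoc ⟩
        (r.F₁ (G.F₁ φ) ∘ w) ∘ idₑ (sym e)   ≈⟨ rGφ∘w≈rψ ⟩∘⟨refl ⟩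
        r.F₁ ψ ∘ idₑ (sym e)                ≈⟨ r-transpose ψ ⟨
        r.F₁ (G.F₁ (♯ ψ))                   ∎

      r-untranspose : ∀ χ → r.F₁ (G.F₁ χ) ≈ w' → r.F₁ (G.F₁ χ B.∘ η X) ≈ w
      r-untranspose χ rGχ≈w' = begin
        r.F₁ (G.F₁ χ B.∘ η X)            ≈⟨ r-G∘η χ ⟩
        r.F₁ (G.F₁ χ) ∘ idₑ e            ≈⟨ rGχ≈w' ⟩∘⟨refl ⟩
        (w ∘ idₑ (sym e)) ∘ idₑ e        ≈⟨ assoc ⟩
        w ∘ (idₑ (sym e) ∘ idₑ e)        ≈⟨ refl⟩∘⟨ idₑ-sym-inverseˡ e ⟩
        w ∘ id                           ≈⟨ identityʳ ⟩
        w                                ∎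

      Gφ∘untranspose : ∀ χ → φ E.∘ χ E.≈ ♯ ψ → G.F₁ φ B.∘ (G.F₁ χ B.∘ η X) B.≈ ψ
      Gφ∘untranspose χ φχ≈♯ψ =
        B.Equiv.trans BP.sym-assoc
          (B.Equiv.trans (B.Equiv.sym G.homomorphism BP.⟩∘⟨refl)
             (B.Equiv.trans (G.F-resp-≈ φχ≈♯ψ BP.⟩∘⟨refl) (♯-spec ψ)))

module FibreTerminalProperties {o ℓ e o' ℓ' e'} {D : Category o' ℓ' e'} {C : Category o ℓ e}
         (V : Functor D C) where
  private
    module D = Category D
    module C = Category C
    module V = Functor V
    module DP = CategoryProperties D
  open CategoryProperties C

  maps-into-fibreTerminal-unique : IsFibration V → HasFibredTerminals V →
                                   ∀ {P T} → IsFibreTerminal V T →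
                                   (g h : P D.⇒ T) → V.F₁ g C.≈ V.F₁ h → g D.≈ h
  maps-into-fibreTerminal-unique fib (_ , reindex) {P} {T} T-terminal g h Vg≈Vh =
    let P' , φ , p , Vφ≈Vg∘p , φ-cartesian = fib T (V.F₁ g)
        Vφ∘p⁻¹≈Vg = idₑ-switchʳ p Vφ≈Vg∘p
        χg , (Vχg , φχg≈g) , _ = φ-cartesian g (C.idₑ (sym p)) Vφ∘p⁻¹≈Vg
        χh , (Vχh , φχh≈h) , _ = φ-cartesian h (C.idₑ (sym p)) (C.Equiv.trans Vφ∘p⁻¹≈Vg Vg≈Vh)
        _ , _ , vertical-unique = reindex φ φ-cartesian T-terminal P (sym p)
        open DP.HomReasoning
    in begin
      g          ≈⟨ φχg≈g ⟨
      φ D.∘ χg   ≈⟨ DP.refl⟩∘⟨ D.Equiv.trans (vertical-unique χg Vχg)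
                                            (D.Equiv.sym (vertical-unique χh Vχh)) ⟩
      φ D.∘ χh   ≈⟨ φχh≈h ⟩
      h          ∎

  -- Lift φ ∘ p opcartesianly and compare the lift with the terminal map into Q.
  fibreTerminal-reindex : IsOpfibration V →
                          ∀ {P Q} (φ : P D.⇒ Q) → IsCartesian V φ →
                          IsFibreTerminal V Q → IsFibreTerminal V P
  fibreTerminal-reindex opfib φ φ-cartesian Q-terminal P' p
    with opfib P' (V.F₁ φ C.∘ C.idₑ p)
  ... | Q' , ψ , p' , Vψ≈ , ψ-opcartesian
    with Q-terminal Q' p'
  ... | t , Vt≈ , t-unique =
    let χ , (Vχ≈ , _) , χ-unique = φ-cartesian (t D.∘ ψ) (C.idₑ p) Vφp≈Vtψ
    in χ , Vχ≈ , λ f Vf≈ → χ-unique f Vf≈ (φf≈tψ f Vf≈)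
    where
      open HomReasoning

      Vφp≈Vtψ : V.F₁ φ C.∘ C.idₑ p C.≈ V.F₁ (t D.∘ ψ)
      Vφp≈Vtψ = begin
        V.F₁ φ C.∘ C.idₑ p    ≈⟨ C.Equiv.sym Vψ≈ ⟩
        C.idₑ p' C.∘ V.F₁ ψ   ≈⟨ C.Equiv.sym Vt≈ ⟩∘⟨refl ⟩
        V.F₁ t C.∘ V.F₁ ψ     ≈⟨ C.Equiv.sym V.homomorphism ⟩
        V.F₁ (t D.∘ ψ)        ∎

      φf≈tψ : ∀ f → V.F₁ f C.≈ C.idₑ p → φ D.∘ f D.≈ t D.∘ ψ
      φf≈tψ f Vf≈ with ψ-opcartesian (φ D.∘ f) (C.idₑ p') (begin
          C.idₑ p' C.∘ V.F₁ ψ  ≈⟨ Vψ≈ ⟩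
          V.F₁ φ C.∘ C.idₑ p   ≈⟨ refl⟩∘⟨ C.Equiv.sym Vf≈ ⟩
          V.F₁ φ C.∘ V.F₁ f    ≈⟨ C.Equiv.sym V.homomorphism ⟩
          V.F₁ (φ D.∘ f)       ∎)
      ... | ζ , (Vζ≈ , ζψ≈φf) , _ =
        D.Equiv.trans (D.Equiv.sym ζψ≈φf) (t-unique ζ Vζ≈ DP.⟩∘⟨refl)

module TruthFunctorProperties {o ℓ e o' ℓ' e'} {D : Category o' ℓ' e'} {C : Category o ℓ e}
         (V : Functor D C) (K : Functor C D) (truth : IsTruthFunctor V K) where
  private
    module D = Category D
    module V = Functor V
    module K = Functor K
  open Category C
  open CategoryProperties C
  open HomReasoning

  eK : ∀ X → V.F₀ (K.F₀ X) ≡ X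
  eK = proj₁ (proj₁ truth)

  VK-agree : ∀ {X Y} (f : X ⇒ Y) → Agree (eK X) (eK Y) (V.F₁ (K.F₁ f)) f
  VK-agree = proj₂ (proj₁ truth)

  ! : ∀ P → P D.⇒ K.F₀ (V.F₀ P)
  ! P = proj₁ (proj₂ truth (V.F₀ P) P (sym (eK (V.F₀ P))))

  V! : ∀ P → V.F₁ (! P) ≈ idₑ (sym (eK (V.F₀ P)))
  V! P = proj₁ (proj₂ (proj₂ truth (V.F₀ P) P (sym (eK (V.F₀ P)))))

  K-lift : ∀ {P X} → V.F₀ P ⇒ X → P D.⇒ K.F₀ X
  K-lift {P} z = K.F₁ z D.∘ ! P

  K-lift-spec : ∀ {P X} (z : V.F₀ P ⇒ X) → idₑ (eK X) ∘ V.F₁ (K-lift z) ≈ z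
  K-lift-spec {P} {X} z = begin
    idₑ (eK X) ∘ V.F₁ (K.F₁ z D.∘ ! P)          ≈⟨ refl⟩∘⟨ V.homomorphism ⟩
    idₑ (eK X) ∘ (V.F₁ (K.F₁ z) ∘ V.F₁ (! P))   ≈⟨ sym-assoc ⟩
    (idₑ (eK X) ∘ V.F₁ (K.F₁ z)) ∘ V.F₁ (! P)   ≈⟨ VK-agree z ⟩∘⟨ V! P ⟩
    (z ∘ idₑ eP) ∘ idₑ (sym eP)                 ≈⟨ assoc ⟩
    z ∘ (idₑ eP ∘ idₑ (sym eP))                 ≈⟨ refl⟩∘⟨ idₑ-sym-inverse eP ⟩
    z ∘ id                                      ≈⟨ identityʳ ⟩
    z                                           ∎
    where eP = eK (V.F₀ P)

  K-lift-resp-≈ : ∀ {P X} {z z' : V.F₀ P ⇒ X} → z ≈ z' → K-lift z D.≈ K-lift z'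
  K-lift-resp-≈ z≈z' = D.∘-resp-≈ (K.F-resp-≈ z≈z') D.Equiv.refl

  K-lift-unique : IsFibration V → HasFibredTerminals V →
                  ∀ {P X} {z : V.F₀ P ⇒ X} (g : P D.⇒ K.F₀ X) →
                  idₑ (eK X) ∘ V.F₁ g ≈ z → g D.≈ K-lift z
  K-lift-unique fib fibredTerminals {X = X} {z} g Vg≈z =
    FibreTerminalProperties.maps-into-fibreTerminal-unique V fib fibredTerminals (proj₂ truth X) g (K-lift z)
      (idₑ-cancelˡ (eK X) (Equiv.trans Vg≈z (Equiv.sym (K-lift-spec z))))

module CodomainFibration {o ℓ e} (B : Category o ℓ e) where
  open Category B
  open CategoryProperties B
  open HomReasoning

  cod-isFibration : HasPullbacks B → IsFibration (cod B)
  cod-isFibration pullback (arr f) u with pullback f u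
  ... | _ , p₁ , p₂ , commute , universal =
    arr p₂ , sq p₁ u commute , refl , Equiv.sym identityʳ , pullback-cartesian
    where
      pullback-cartesian : IsCartesian (cod B) (sq p₁ u commute)
      pullback-cartesian {arr h} (sq s t fs≈th) v uv≈t =
        let z , p₁z≈s , p₂z≈vh , z-unique = universal s (v ∘ h) (begin
              f ∘ s        ≈⟨ fs≈th ⟩
              t ∘ h        ≈⟨ Equiv.sym uv≈t ⟩∘⟨refl ⟩
              (u ∘ v) ∘ h  ≈⟨ assoc ⟩
              u ∘ (v ∘ h)  ∎)
        in sq z v p₂z≈vh , (Equiv.refl , p₁z≈s , uv≈t) ,
           λ { (sq z' v' p₂z'≈v'h) v'≈v (p₁z'≈s , _) →
                 z-unique z' p₁z'≈s (Equiv.trans p₂z'≈v'h (v'≈v ⟩∘⟨refl)) , v'≈v }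

module CCUProperties {o ℓ e o' ℓ' e'} {B : Category o ℓ e} {E : Category o' ℓ' e'}
         (U : Functor E B) (ccu : CCU U) where
  open CCU ccu
  private
    module E = Category E
    module U = Functor U
    module K = Functor K
    module Cmp = Functor compr
  open Category B
  open CategoryProperties B
  open HomReasoning
  open TruthFunctorProperties U K truth public hiding (K-lift-unique)
  open AdjunctionProperties K⊣compr public

  K-lift-unique : ∀ {P X} {z : U.F₀ P ⇒ X} (g : P E.⇒ K.F₀ X) →
                  idₑ (eK X) ∘ U.F₁ g ≈ z → g E.≈ K-lift z
  K-lift-unique = TruthFunctorProperties.K-lift-unique U K truth fibration fibredTerminals

  K-lift-∘ : ∀ {P Q X} (z : U.F₀ Q ⇒ X) (m : P E.⇒ Q) → K-lift z E.∘ m E.≈ K-lift (z ∘ U.F₁ m)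
  K-lift-∘ {X = X} z m = K-lift-unique (K-lift z E.∘ m) (begin
    idₑ (eK X) ∘ U.F₁ (K-lift z E.∘ m)       ≈⟨ refl⟩∘⟨ U.homomorphism ⟩
    idₑ (eK X) ∘ (U.F₁ (K-lift z) ∘ U.F₁ m)  ≈⟨ sym-assoc ⟩
    (idₑ (eK X) ∘ U.F₁ (K-lift z)) ∘ U.F₁ m  ≈⟨ K-lift-spec z ⟩∘⟨refl ⟩
    z ∘ U.F₁ m                               ∎)

  π : ∀ P → Cmp.F₀ P ⇒ U.F₀ P
  π P = U.F₁ (ε P) ∘ idₑ (sym (eK (Cmp.F₀ P)))

  U-ε∘K : ∀ {X P} (s : X ⇒ Cmp.F₀ P) → U.F₁ (ε P E.∘ K.F₁ s) ≈ (π P ∘ s) ∘ idₑ (eK X)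
  U-ε∘K {X} {P} s = begin
    U.F₁ (ε P E.∘ K.F₁ s)                                 ≈⟨ U.homomorphism ⟩
    U.F₁ (ε P) ∘ U.F₁ (K.F₁ s)                            ≈⟨ refl⟩∘⟨ agree⇒≈transport (eK X) eP (VK-agree s) ⟩
    U.F₁ (ε P) ∘ ((idₑ (sym eP) ∘ s) ∘ idₑ (eK X))        ≈⟨ sym-assoc ⟩
    (U.F₁ (ε P) ∘ (idₑ (sym eP) ∘ s)) ∘ idₑ (eK X)        ≈⟨ sym-assoc ⟩∘⟨refl ⟩
    (π P ∘ s) ∘ idₑ (eK X)                                ∎
    where eP = eK (Cmp.F₀ P)

  π-natural : ∀ {P Q} (m : P E.⇒ Q) → π Q ∘ Cmp.F₁ m ≈ U.F₁ m ∘ π P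
  π-natural {P} {Q} m = Equiv.sym (begin
    U.F₁ m ∘ (U.F₁ (ε P) ∘ idₑ (sym eP))           ≈⟨ sym-assoc ⟩
    (U.F₁ m ∘ U.F₁ (ε P)) ∘ idₑ (sym eP)           ≈⟨ Equiv.sym U.homomorphism ⟩∘⟨refl ⟩
    U.F₁ (m E.∘ ε P) ∘ idₑ (sym eP)                ≈⟨ U.F-resp-≈ (ε-natural m) ⟩∘⟨refl ⟩
    U.F₁ (ε Q E.∘ K.F₁ (Cmp.F₁ m)) ∘ idₑ (sym eP)  ≈⟨ idₑ-switchʳ eP (U-ε∘K (Cmp.F₁ m)) ⟩
    π Q ∘ Cmp.F₁ m                                 ∎)
    where eP = eK (Cmp.F₀ P)

  π-η : ∀ X → idₑ (eK X) ∘ (π (K.F₀ X) ∘ η X) ≈ id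
  π-η X = idₑ-inverse-commute (eK X) (begin
    (π (K.F₀ X) ∘ η X) ∘ idₑ (eK X)     ≈⟨ Equiv.sym (U-ε∘K (η X)) ⟩
    U.F₁ (ε (K.F₀ X) E.∘ K.F₁ (η X))   ≈⟨ U.F-resp-≈ (zig X) ⟩
    U.F₁ E.id                          ≈⟨ U.identity ⟩
    id                                 ∎)

module DomainChangeOfBase {o ℓ e o' ℓ' e'} {B : Category o ℓ e} {E : Category o' ℓ' e'}
         (U : Functor E B) (L : LawvereCategory U) where
  open LawvereCategory L using (ccu; fibration; opfibration; truth; K; compr; K⊣compr)
  open CCUProperties U ccu
  private
    module E = Category E
    module U = Functor U
    module K = Functor K
    module Cmp = Functor compr
    module Ar = Category (Arrow B)
    module E′ = Category (E′ U)
  open Category B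
  open CategoryProperties B
  open HomReasoning

  q-bifibration : IsBifibration (q U)
  q-bifibration = ChangeOfBaseProperties.isFibration U (dom B) fibration ,
                  ChangeOfBaseProperties.isOpfibration U (dom B) opfibration

  K′ : Functor (Arrow B) (E′ U)
  K′ = record
    { F₀ = λ X → pbobj X (K.F₀ (ArrowObj.src X)) (eK _)
    ; F₁ = λ f → pbhom f (K.F₁ (ArrowHom.u f)) (VK-agree _)
    ; identity = (Equiv.refl , Equiv.refl) , K.identity
    ; homomorphism = (Equiv.refl , Equiv.refl) , K.homomorphism
    ; F-resp-≈ = λ f≈g → f≈g , K.F-resp-≈ (proj₁ f≈g)
    }

  K′-fibreTerminal : ∀ X → IsFibreTerminal (q U) (F₀ K′ X)
  K′-fibreTerminal (arr _) (pbobj _ _ refl) refl =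
    pbhom Ar.id (K-lift id) (Equiv.trans (K-lift-spec id) (Equiv.sym identityˡ)) ,
    (Equiv.refl , Equiv.refl) ,
    λ { (pbhom α m Um≈α) α≈id →
          α≈id , K-lift-unique m (Equiv.trans Um≈α (Equiv.trans identityʳ (proj₁ α≈id))) }

  K′-truth : IsTruthFunctor (q U) K′
  K′-truth = ((λ X → refl) , λ f → id-comm , id-comm) , K′-fibreTerminal

  compr′₀ : E′.Obj → ArrowObj B
  compr′₀ (pbobj (arr f) P ov) = arr (f ∘ (idₑ ov ∘ π P))

  compr′-square : ∀ {X Y} (h : X E′.⇒ Y) →
                  ArrowObj.map (compr′₀ Y) ∘ Cmp.F₁ (PbHom.fib-mor h) ≈
                  ArrowHom.v (PbHom.idx-mor h) ∘ ArrowObj.map (compr′₀ X)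
  compr′-square {pbobj (arr f) P refl} {pbobj (arr g) Q refl} (pbhom (sq u v gu≈vf) m Um≈u) = begin
    (g ∘ (id ∘ π Q)) ∘ Cmp.F₁ m   ≈⟨ (refl⟩∘⟨ identityˡ) ⟩∘⟨refl ⟩
    (g ∘ π Q) ∘ Cmp.F₁ m          ≈⟨ assoc ⟩
    g ∘ (π Q ∘ Cmp.F₁ m)          ≈⟨ refl⟩∘⟨ π-natural m ⟩
    g ∘ (U.F₁ m ∘ π P)            ≈⟨ refl⟩∘⟨ (agree-refl⁻ Um≈u ⟩∘⟨refl) ⟩
    g ∘ (u ∘ π P)                 ≈⟨ sym-assoc ⟩
    (g ∘ u) ∘ π P                 ≈⟨ gu≈vf ⟩∘⟨refl ⟩
    (v ∘ f) ∘ π P                 ≈⟨ assoc ⟩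
    v ∘ (f ∘ π P)                 ≈⟨ refl⟩∘⟨ (refl⟩∘⟨ Equiv.sym identityˡ) ⟩
    v ∘ (f ∘ (id ∘ π P))          ∎

  compr′ : Functor (E′ U) (Arrow B)
  compr′ = record
    { F₀ = compr′₀
    ; F₁ = λ h → sq (Cmp.F₁ (PbHom.fib-mor h)) (ArrowHom.v (PbHom.idx-mor h)) (compr′-square h)
    ; identity = Cmp.identity , Equiv.refl
    ; homomorphism = Cmp.homomorphism , Equiv.refl
    ; F-resp-≈ = λ h≈h' → Cmp.F-resp-≈ (proj₂ h≈h') , proj₂ (proj₁ h≈h')
    }

  unit-square : ∀ {Y J} (g : Y ⇒ J) → (g ∘ (idₑ (eK Y) ∘ π (K.F₀ Y))) ∘ η Y ≈ id ∘ g
  unit-square {Y} g = begin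
    (g ∘ (idₑ (eK Y) ∘ π (K.F₀ Y))) ∘ η Y   ≈⟨ assoc ⟩
    g ∘ ((idₑ (eK Y) ∘ π (K.F₀ Y)) ∘ η Y)   ≈⟨ refl⟩∘⟨ assoc ⟩
    g ∘ (idₑ (eK Y) ∘ (π (K.F₀ Y) ∘ η Y))   ≈⟨ refl⟩∘⟨ π-η Y ⟩
    g ∘ id                                  ≈⟨ id-comm ⟨
    id ∘ g                                  ∎

  unit′ : NaturalTransformation (IdF (Arrow B)) (compr′ ∘F K′)
  unit′ = record
    { η = λ X → sq (η (ArrowObj.src X)) id (unit-square (ArrowObj.map X))
    ; commute = λ f → η-commute (ArrowHom.u f) , id-comm
    }

  transpose′ : ∀ {X A} (g : X Ar.⇒ compr′₀ A) →
               Σ[ f ∈ F₀ K′ X E′.⇒ A ]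
                 ((F₁ compr′ f Ar.∘ NaturalTransformation.η unit′ X Ar.≈ g) ×
                  (∀ (f' : F₀ K′ X E′.⇒ A) →
                     F₁ compr′ f' Ar.∘ NaturalTransformation.η unit′ X Ar.≈ g → f' E′.≈ f))
  transpose′ {arr {Y} g} {pbobj (arr f) P refl} (sq a b fπa≈bg) =
    pbhom (sq (π P ∘ a) b square) (♯ a) (U-over (♯ a) E.Equiv.refl) , (♯-spec a , identityʳ) ,
    λ { (pbhom (sq u' _ _) m' Um'≈u') (Cm'η≈a , v'≈b) →
          let m'≈♯a = ♯-unique m' Cm'η≈a in
          (agree-uniqueʳ (eK Y) refl Um'≈u' (U-over m' m'≈♯a) , Equiv.trans (Equiv.sym identityʳ) v'≈b) ,
          m'≈♯a }
    where
      square : f ∘ (π P ∘ a) ≈ b ∘ g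
      square = Equiv.trans sym-assoc (Equiv.trans ((refl⟩∘⟨ Equiv.sym identityˡ) ⟩∘⟨refl) fπa≈bg)

      U-over : ∀ m → m E.≈ ♯ a → Agree (eK Y) refl (U.F₁ m) (π P ∘ a)
      U-over m m≈♯a =
        Equiv.trans identityˡ (Equiv.trans (U.F-resp-≈ (E.Equiv.trans m≈♯a (♯≈ε∘L a))) (U-ε∘K a))

  K′⊣compr′ : Adjunction K′ compr′
  K′⊣compr′ = record { unit = unit′ ; universal = transpose′ }

  compr′-cartesian : ∀ {P Q} (φ : P E′.⇒ Q) →
                     IsCartesian (cod B ∘F q U) φ → IsCartesian (cod B) (F₁ compr′ φ)
  compr′-cartesian = right-adjoint-preserves-cartesian (cod B) K′⊣compr′ (λ X → refl , Equiv.refl)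

  K′-cartesian : ∀ {X Y} (f : X Ar.⇒ Y) → IsCartesian (cod B) f → IsCartesian (cod B ∘F q U) (F₁ K′ f)
  K′-cartesian {arr _} {arr {X} _} (sq u _ _) f-cartesian {pbobj (arr _) P refl} (pbhom β n Un≈uβ) w vw≈ =
    let β' , (vβ'≈w , fβ'≈β) , β'-unique = f-cartesian β w vw≈ in
    pbhom β' (K-lift (ArrowHom.u β')) (lift-agree (ArrowHom.u β')) ,
    (vβ'≈w , fβ'≈β , Ku∘ΦΨ-liftn (ArrowHom.u β') (proj₁ fβ'≈β)) ,
    λ { (pbhom β'' m'' Um''≈) vβ''≈w (fβ''≈β , _) →
          let β''≈β' = β'-unique β'' vβ''≈w fβ''≈β in
          β''≈β' , K-lift-unique m'' (Equiv.trans Um''≈ (Equiv.trans identityʳ (proj₁ β''≈β'))) }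
    where
      lift-agree : ∀ {Z} (z : U.F₀ P ⇒ Z) → Agree refl (eK Z) (U.F₁ (K-lift z)) z
      lift-agree z = Equiv.trans (K-lift-spec z) (Equiv.sym identityʳ)

      Ku∘ΦΨ-liftn : ∀ z → u ∘ z ≈ ArrowHom.u β → K.F₁ u E.∘ K-lift z E.≈ n
      Ku∘ΦΨ-liftn z uz≈uβ = E.Equiv.trans
        (K-lift-unique (K.F₁ u E.∘ K-lift z) (begin
          idₑ (eK X) ∘ U.F₁ (K.F₁ u E.∘ K-lift z)
            ≈⟨ refl⟩∘⟨ U.homomorphism ⟩
          idₑ (eK X) ∘ (U.F₁ (K.F₁ u) ∘ U.F₁ (K-lift z))
            ≈⟨ agree-∘ refl (eK _) (eK X) (VK-agree u) (lift-agree z) ⟩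
          (u ∘ z) ∘ id
            ≈⟨ identityʳ ⟩
          u ∘ z
            ≈⟨ uz≈uβ ⟩
          ArrowHom.u β
            ∎))
        (E.Equiv.sym (K-lift-unique n (Equiv.trans Un≈uβ identityʳ)))

  q-fibredLawvere : HasPullbacks B → FibredLawvere (q U) (cod B)
  q-fibredLawvere pullback = record
    { r-fibration = CodomainFibration.cod-isFibration B pullback
    ; bifibration = q-bifibration
    ; fibredTerminals = (λ X → F₀ K′ X , refl , K′-fibreTerminal X) ,
                        FibreTerminalProperties.fibreTerminal-reindex (q U) (proj₂ q-bifibration)
    ; K' = K′
    ; truth = K′-truth
    ; compr = compr′
    ; K'⊣compr = K′⊣compr′
    ; K'-cartesian = K′-cartesian
    ; compr-cartesian = compr′-cartesian
    ; K'-over = (λ X → refl) , λ f → id-comm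
    ; compr-over = (λ X → refl) , λ f → id-comm
    ; unit-vertical = λ X → refl , Equiv.refl
    }

  module _ (I : Obj) where
    private
      Fib = Fibre (cod B ∘F q U) I
      module Fib = Category Fib
      module SE = SliceProperties E
      module SB = SliceProperties B
      module SlB = Category (Slice B I)
      module EP = CategoryProperties E

    fibreObj : ∀ {P} → U.F₀ P ⇒ I → FibreObj (cod B ∘F q U) I
    fibreObj {P} f = fibreobj {obj = pbobj (arr f) P refl} refl

    fibre-id : ∀ {P} {f f' : U.F₀ P ⇒ I} → f ≈ f' → fibreObj f Fib.⇒ fibreObj f'
    fibre-id f≈f' = fibrehom (pbhom (sq id id square) E.id (agree-refl U.identity)) identityˡ
      where square = Equiv.trans identityʳ (Equiv.trans (Equiv.sym f≈f') (Equiv.sym identityˡ))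

    fibre-id-iso : ∀ {P} {f f' : U.F₀ P ⇒ I} (f≈f' : f ≈ f') → Fib.IsIso (fibre-id f≈f')
    fibre-id-iso f≈f' = fibre-id (Equiv.sym f≈f') ,
                        ((identityˡ , identityˡ) , E.identityˡ) , ((identityˡ , identityˡ) , E.identityˡ)

    fibre-arrow : (X : FibreObj (cod B ∘F q U) I) → U.F₀ (PbObj.fib (FibreObj.obj X)) ⇒ I
    fibre-arrow (fibreobj {pbobj (arr f) _ ov} over) = idₑ over ∘ (f ∘ idₑ ov)

    fibre-arrow-∘ : ∀ {X Y} (g : X Fib.⇒ Y) →
                    fibre-arrow Y ∘ U.F₁ (PbHom.fib-mor (FibreHom.mor g)) ≈ fibre-arrow X
    fibre-arrow-∘ {fibreobj {pbobj (arr f) _ refl} refl} {fibreobj {pbobj (arr f') _ refl} refl}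
                  (fibrehom (pbhom (sq u v f'u≈vf) m Um≈u) v≈id) = begin
      (id ∘ (f' ∘ id)) ∘ U.F₁ m   ≈⟨ Equiv.trans identityˡ identityʳ ⟩∘⟨ agree-refl⁻ Um≈u ⟩
      f' ∘ u                      ≈⟨ f'u≈vf ⟩
      v ∘ f                       ≈⟨ Equiv.trans (Equiv.sym identityˡ) v≈id ⟩∘⟨refl ⟩
      id ∘ f                      ≈⟨ refl⟩∘⟨ Equiv.sym identityʳ ⟩
      id ∘ (f ∘ id)               ∎

    Φ : Functor Fib (Slice E (K.F₀ I))
    Φ = record
      { F₀ = λ X → sliceobj (K-lift (fibre-arrow X))
      ; F₁ = λ {X} {Y} g → slicehom (PbHom.fib-mor (FibreHom.mor g))
               (E.Equiv.trans (K-lift-∘ (fibre-arrow Y) _) (K-lift-resp-≈ (fibre-arrow-∘ g)))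
      ; identity = E.Equiv.refl
      ; homomorphism = E.Equiv.refl
      ; F-resp-≈ = proj₂
      }

    Ψ : Functor (Slice E (K.F₀ I)) Fib
    Ψ = record
      { F₀ = λ { (sliceobj k) → fibreObj (idₑ (eK I) ∘ U.F₁ k) }
      ; F₁ = λ { {sliceobj k} {sliceobj k'} (slicehom h k'h≈k) →
                 fibrehom (pbhom (sq (U.F₁ h) id (square k k' h k'h≈k)) h id-comm) identityˡ }
      ; identity = (U.identity , Equiv.refl) , E.Equiv.refl
      ; homomorphism = (U.homomorphism , Equiv.sym identityˡ) , E.Equiv.refl
      ; F-resp-≈ = λ h≈h' → (U.F-resp-≈ h≈h' , Equiv.refl) , h≈h'
      }
      where
        square : ∀ {P P'} (k : P E.⇒ K.F₀ I) (k' : P' E.⇒ K.F₀ I) (h : P E.⇒ P') →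
                 k' E.∘ h E.≈ k →
                 (idₑ (eK I) ∘ U.F₁ k') ∘ U.F₁ h ≈ id ∘ (idₑ (eK I) ∘ U.F₁ k)
        square k k' h k'h≈k = begin
          (idₑ (eK I) ∘ U.F₁ k') ∘ U.F₁ h   ≈⟨ assoc ⟩
          idₑ (eK I) ∘ (U.F₁ k' ∘ U.F₁ h)   ≈⟨ refl⟩∘⟨ Equiv.sym U.homomorphism ⟩
          idₑ (eK I) ∘ U.F₁ (k' E.∘ h)      ≈⟨ refl⟩∘⟨ U.F-resp-≈ k'h≈k ⟩
          idₑ (eK I) ∘ U.F₁ k               ≈⟨ identityˡ ⟨
          id ∘ (idₑ (eK I) ∘ U.F₁ k)        ∎

    ΨΦ-arrow : ∀ {P} (f : U.F₀ P ⇒ I) → idₑ (eK I) ∘ U.F₁ (K-lift (id ∘ (f ∘ id))) ≈ f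
    ΨΦ-arrow f = Equiv.trans (K-lift-spec _) (Equiv.trans identityˡ identityʳ)

    ΨΦ≅id : NaturalIso (Ψ ∘F Φ) (IdF Fib)
    ΨΦ≅id = record { η = component ; commute = commute } ,
            λ { (fibreobj {pbobj (arr f) _ refl} refl) → fibre-id-iso (ΨΦ-arrow f) }
      where
        component : ∀ X → F₀ (Ψ ∘F Φ) X Fib.⇒ X
        component (fibreobj {pbobj (arr f) _ refl} refl) = fibre-id (ΨΦ-arrow f)

        commute : ∀ {X Y} (g : X Fib.⇒ Y) →
                  component Y Fib.∘ F₁ (Ψ ∘F Φ) g Fib.≈ g Fib.∘ component X
        commute {fibreobj {pbobj (arr _) _ refl} refl} {fibreobj {pbobj (arr _) _ refl} refl}
                (fibrehom (pbhom _ _ Um≈u) v≈id) =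
          (Um≈u , Equiv.trans identityˡ (Equiv.trans (Equiv.sym v≈id) id-comm)) , EP.id-comm

    ΦΨ≅id : NaturalIso (Φ ∘F Ψ) (IdF (Slice E (K.F₀ I)))
    ΦΨ≅id = record { η = λ { (sliceobj k) → SE.slice-id (ΦΨ-lift k) }
                   ; commute = λ { {sliceobj _} {sliceobj _} _ → EP.id-comm } } ,
            λ { (sliceobj k) → SE.slice-id-iso (ΦΨ-lift k) }
      where
        ΦΨ-lift : ∀ {P} (k : P E.⇒ K.F₀ I) → K-lift (id ∘ ((idₑ (eK I) ∘ U.F₁ k) ∘ id)) E.≈ k
        ΦΨ-lift k = E.Equiv.sym (K-lift-unique k (Equiv.trans (Equiv.sym identityʳ) (Equiv.sym identityˡ)))

    U/I∘Φ≅q-restr : NaturalIso (U/I U K truth I ∘F Φ) (q-restr U I)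
    U/I∘Φ≅q-restr = record { η = component ; commute = commute } ,
                    λ { (fibreobj {pbobj (arr f) _ refl} refl) → SB.slice-id-iso (U/I-Φ-arrow f) }
      where
        U/I-Φ-arrow : ∀ {P} (f : U.F₀ P ⇒ I) →
                      idₑ (eK I) ∘ U.F₁ (K-lift (id ∘ (f ∘ id))) ≈ id ∘ f
        U/I-Φ-arrow f = Equiv.trans (ΨΦ-arrow f) (Equiv.sym identityˡ)

        component : ∀ X → F₀ (U/I U K truth I ∘F Φ) X SlB.⇒ F₀ (q-restr U I) X
        component (fibreobj {pbobj (arr f) _ refl} refl) = SB.slice-id (U/I-Φ-arrow f)

        commute : ∀ {X Y} (g : X Fib.⇒ Y) →
                  component Y SlB.∘ F₁ (U/I U K truth I ∘F Φ) g SlB.≈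
                  F₁ (q-restr U I) g SlB.∘ component X
        commute {fibreobj {pbobj (arr _) _ refl} refl} {fibreobj {pbobj (arr _) _ refl} refl}
                (fibrehom (pbhom _ _ Um≈u) _) = Um≈u

lemma6p9 : ∀ {o ℓ e o' ℓ' e' : Level}
             (B : Category o ℓ e) (E : Category o' ℓ' e') (U : Functor E B) →
             HasPullbacks B →
             (L : LawvereCategory U) →
             FibredLawvere (q U) (cod B) ×
             (∀ (I : Category.Obj B) →
                Σ[ Φ ∈ Functor (Fibre (cod B ∘F q U) I) (Slice E (F₀ (LawvereCategory.K L) I)) ]
                  (IsEquivalenceF Φ ×
                   NaturalIso (U/I U (LawvereCategory.K L) (LawvereCategory.truth L) I ∘F Φ) (q-restr U I)))
lemma6p9 B E U pullback L =
  q-fibredLawvere pullback ,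
  λ I → Φ I , (Ψ I , ΨΦ≅id I , ΦΨ≅id I) , U/I∘Φ≅q-restr I
  where open DomainChangeOfBase U L
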